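{- Let $\mathcal{M}=(E,\mathcal{I})$ be a matroid of rank $r$, unknown to the algorithm, whose elements arrive in an adversarial order $e_1,\dots,e_n$ with adversarially chosen non-negative weights $\omega:E\to W$ (revealed on arrival; each element must be irrevocably accepted or rejected, the accepted set always independent; only subsets of already arrived elements can be queried for independence). Let $e_1^*$ and $e_2^*$ be the largest and second largest non-loop elements with respect to $\omega$, and suppose the algorithm is given a number $L$ with $\omega(e_2^*)<L<\omega(e_1^*)$. Consider the following algorithm: (1) With probability $1/2$, select the (first) arriving non-loop element with weight above $L$ and return it. (2) Otherwise set $\mathrm{ALG}=\emptyset$, $r^*=2$, $w^*=L/2$; for each arriving element $e_i$: if $\omega(e_i)>w^*$ and $\mathrm{ALG}\cup\{e_i\}$ is independent, add $e_i$ to $\mathrm{ALG}$; then if $\mathrm{rank}(\{e_1,\dots,e_i\})\ge r^*$, with probability $\frac{1}{\log(2r^*)}$ set $w^*=L/(2r^*)$, and set $r^*=2r^*$. Return $\mathrm{ALG}$. Then $$\mathbb{E}[w(\mathrm{ALG}(\omega))]\ \ge\ \frac{1}{16\log r}\,w(\mathrm{OPT}(\omega)),$$ where the expectation is over the randomness of the algorithm and $\mathrm{OPT}(\omega)$ is a maximum-weight independent set.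
   Context: $w(S)=\sum_{e\in S}\omega(e)$; $\log$ is base 2. A loop is an element $e$ with $\{e\}$ dependent.
   Formalization: The weights ω(e) and the number L are taken to be rational instead of real, and the rank r is assumed to be at least 2, since for r = 1 the bound 1/(16 log r) is undefined. -}

module Defs where

open import Data.Bool using (Bool; true; false; if_then_else_; _∧_)
open import Data.Nat as ℕ using (ℕ; zero; suc; _≤ᵇ_; _<ᵇ_; _^_)
open import Data.Nat.Logarithm using (⌊log₂_⌋)
open import Data.Integer as ℤ using (ℤ; +_)
open import Data.Rational using (ℚ; _+_; _*_; _-_; _≤_; _<_; _/_; 0ℚ; 1ℚ; ½; ↥_; ↧ₙ_)
open import Data.Rational.Properties using (_<?_)
open import Data.Fin using (Fin; toℕ)
open import Data.Fin.Subset using (Subset; ⁅_⁆; _∪_; _∈_; _∉_; _⊆_; ∣_∣)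
  renaming (⊥ to ∅)
open import Data.Fin.Subset.Properties using (_⊆?_)
open import Data.List using (List; []; _∷_; foldr; map)
open import Data.List.Base using (allFin)
open import Data.Vec using (Vec; []; _∷_; lookup; tabulate)
open import Data.Product using (Σ; ∃; _×_; _,_)
open import Relation.Nullary using (¬_; Dec; does)
open import Relation.Unary using (Decidable)

-- Matroids on the ground set Fin n.  Element i : Fin n is the element
-- e_{i+1}, i.e. the index is the (adversarial) arrival position.

record Matroid (n : ℕ) : Set₁ where
  field
    Indep    : Subset n → Set
    indep?   : Decidable Indep
    indep-∅  : Indep ∅
    indep-⊆  : ∀ {A B} → B ⊆ A → Indep A → Indep B
    exchange : ∀ {A B} → Indep A → Indep B → ∣ A ∣ ℕ.< ∣ B ∣ →
               ∃ λ x → x ∈ B × x ∉ A × Indep (⁅ x ⁆ ∪ A)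

  Loop : Fin n → Set
  Loop e = ¬ Indep ⁅ e ⁆

  isLoopᵇ : Fin n → Bool
  isLoopᵇ e = if does (indep? ⁅ e ⁆) then false else true

allSubsets : ∀ n → List (Subset n)
allSubsets zero    = [] ∷ []
allSubsets (suc n) = foldr (λ s acc → (true ∷ s) ∷ (false ∷ s) ∷ acc) [] (allSubsets n)

maxℕ : List ℕ → ℕ
maxℕ = foldr ℕ._⊔_ 0

module _ {n : ℕ} (M : Matroid n) where
  open Matroid M

  rank : Subset n → ℕ
  rank S = maxℕ (map (λ A → if does (A ⊆? S) ∧ does (indep? A) then ∣ A ∣ else 0)
                     (allSubsets n))

  rankM : ℕ
  rankM = rank (tabulate (λ _ → true))

prefix : ∀ {n} → ℕ → Subset n
prefix i = tabulate (λ j → toℕ j <ᵇ i)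

weight : ∀ {n} → (Fin n → ℚ) → Subset n → ℚ
weight {n} ω S = foldr _+_ 0ℚ (map (λ i → if lookup S i then ω i else 0ℚ) (allFin n))

-- 1/k as a rational (0 for k = 0, never used at k = 0)
inv : ℕ → ℚ
inv zero    = 0ℚ
inv (suc k) = + 1 / suc k

module Algorithm {n : ℕ} (M : Matroid n) (ω : Fin n → ℚ) (L : ℚ) where
  open Matroid M

  branch1 : List (Fin n) → ℚ
  branch1 []       = 0ℚ
  branch1 (e ∷ es) = if (if isLoopᵇ e then false else does (L <? ω e))
                     then ω e else branch1 es

  -- Branch (2): expected weight of ALG, given remaining arrivals, the
  -- current ALG, r* and w*.  When rank({e_1..e_i}) ≥ r*, with
  -- probability 1/log₂(2r*) set w* = L/(2r*); in any case r* := 2r*.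
  branch2 : List (Fin n) → Subset n → ℕ → ℚ → ℚ
  branch2 []       alg r w = weight ω alg
  branch2 (e ∷ es) alg r w =
    let alg' = if does (w <? ω e) ∧ does (indep? (⁅ e ⁆ ∪ alg))
               then ⁅ e ⁆ ∪ alg else alg
        p    = inv ⌊log₂ (2 ℕ.* r) ⌋
    in if r ≤ᵇ rank M (prefix (suc (toℕ e)))
       then p * branch2 es alg' (2 ℕ.* r) (L * inv (2 ℕ.* r))
            + (1ℚ - p) * branch2 es alg' (2 ℕ.* r) w
       else branch2 es alg' r w

  expectedALG : ℚ
  expectedALG = ½ * branch1 (allFin n) + ½ * branch2 (allFin n) ∅ 2 (L * ½)

IsMaxWeightIndep : ∀ {n} → Matroid n → (Fin n → ℚ) → Subset n → Set
IsMaxWeightIndep M ω S =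
  Matroid.Indep M S × (∀ T → Matroid.Indep M T → weight ω T ≤ weight ω S)

-- a ≤ c · log₂ r   for rationals a, c ≥ 0 and r ∈ ℕ, r ≥ 1.
-- Either a ≤ 0, or c > 0 and 2^(a/c) ≤ r, the latter written with
-- a = p₁/q₁, c = p₂/q₂ as 2^(p₁ q₂) ≤ r^(q₁ p₂).
_≤_·log₂_ : ℚ → ℚ → ℕ → Set
a ≤ c ·log₂ r = (a ≤ 0ℚ) ⊎′ ((0ℚ < c) × (2 ^ (ℤ.∣ ↥ a ∣ ℕ.* ↧ₙ c) ℕ.≤ r ^ (↧ₙ a ℕ.* ℤ.∣ ↥ c ∣)))
  where open import Data.Sum using () renaming (_⊎_ to _⊎′_)

{-# OPTIONS --safe #-}

-- Let 2^k ≤ r < 2^(k+1), K = k + 1 and θᵢ = L/2ⁱ.  In branch (2) the final threshold w* is uniform over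
-- θ₁, …, θ_K, because the j-th doubling replaces it with probability 1/(j+1).  The elements of OPT arriving
-- before θᵢ₊₁ can come into force number at most 2ⁱ, the rank at that moment.  If θᵢ₊₁ is the final threshold,
-- ALG ends up spanning all later elements of OPT heavier than θᵢ₊₁, so by exchange it has at least as many
-- elements as these, each of weight above θᵢ₊₁.  Slicing the weight of OPT along the θᵢ, the early elements cost
-- at most L per slice, the elements below θ_K at most L in total, and both are paid for by branch (1), which
-- always earns ω(e₁*) > L.

module Submission where

open import Defs
open import Data.Bool using (Bool; true; false; if_then_else_; _∧_; T)
open import Data.Nat as ℕ using (ℕ; zero; suc; _^_; z≤n; s≤s)
import Data.Nat.Properties as ℕₚ
open import Data.Nat.Logarithm using (⌊log₂_⌋; ⌊log₂[2^n]⌋≡n)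
open import Data.Integer as ℤ using (+_; -[1+_])
import Data.Integer.Properties as ℤₚ
open import Data.Rational as ℚ using (ℚ; mkℚ; _+_; _*_; _-_; _≤_; _<_; _/_; 0ℚ; 1ℚ; ½; toℚᵘ; ↥_; ↧ₙ_)
open import Data.Rational.Properties
open import Data.Rational.Solver using (module +-*-Solver)
open import Data.Rational.Unnormalised as ℚᵘ using (mkℚᵘ; *≡*)
import Data.Rational.Unnormalised.Properties as ℚᵘₚ
open import Data.Fin using (Fin; zero; suc; toℕ)
import Data.Fin.Properties as Finₚ
open import Data.Fin.Subset using (Subset; ⊥; ⁅_⁆; _∪_; _∩_; ∁; _∈_; _⊆_; ∣_∣)
open import Data.Fin.Subset.Properties
open import Data.List using (List; []; _∷_; map; foldr; allFin)
import Data.List as List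
open import Data.List.Membership.Propositional using () renaming (_∈_ to _∈ₗ_)
open import Data.List.Membership.Propositional.Properties using (∈-allFin)
open import Data.List.Properties using (map-tabulate)
open import Data.List.Relation.Unary.Any using (here; there)
open import Data.Vec using ([]; _∷_; here; there; lookup; tabulate)
open import Data.Vec.Properties using (lookup∘tabulate; []=⇒lookup; lookup⇒[]=)
open import Data.Product using (Σ; ∃; _×_; _,_)
open import Data.Sum using (_⊎_; inj₁; inj₂)
open import Function using (_∘_; id; case_of_)
open import Relation.Nullary using (¬_; Dec; yes; no; does; contradiction)
open import Relation.Nullary.Decidable using (_×-dec_; ¬?; dec-true; dec-false; decidable-stable)
open import Relation.Binary.PropositionalEquality hiding (J)

-- Subsets, prefixes and maxima over all subsets

∈-tabulate⁺ : ∀ {n} {f : Fin n → Bool} {i} → f i ≡ true → i ∈ tabulate f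
∈-tabulate⁺ {f = f} {i} fi = lookup⇒[]= i _ (trans (lookup∘tabulate f i) fi)

∈-tabulate⁻ : ∀ {n} {f : Fin n → Bool} {i} → i ∈ tabulate f → f i ≡ true
∈-tabulate⁻ {f = f} {i} i∈ = trans (sym (lookup∘tabulate f i)) ([]=⇒lookup i∈)

∣p∣≡∣p∩q∣+∣p∩∁q∣ : ∀ {n} (p q : Subset n) → ∣ p ∣ ≡ ∣ p ∩ q ∣ ℕ.+ ∣ p ∩ ∁ q ∣
∣p∣≡∣p∩q∣+∣p∩∁q∣ []          []          = refl
∣p∣≡∣p∩q∣+∣p∩∁q∣ (false ∷ p) (_ ∷ q)     = ∣p∣≡∣p∩q∣+∣p∩∁q∣ p q
∣p∣≡∣p∩q∣+∣p∩∁q∣ (true ∷ p)  (true ∷ q)  = cong suc (∣p∣≡∣p∩q∣+∣p∩∁q∣ p q)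
∣p∣≡∣p∩q∣+∣p∩∁q∣ (true ∷ p)  (false ∷ q) =
  trans (cong suc (∣p∣≡∣p∩q∣+∣p∩∁q∣ p q)) (sym (ℕₚ.+-suc _ _))

∈-prefix⁺ : ∀ {n t} {e : Fin n} → toℕ e ℕ.< t → e ∈ prefix t
∈-prefix⁺ e<t = ∈-tabulate⁺ (T-≡ (ℕₚ.<⇒<ᵇ e<t))
  where
  T-≡ : ∀ {b} → T b → b ≡ true
  T-≡ {true} _ = refl

∈-prefix⁻ : ∀ {n t} {e : Fin n} → e ∈ prefix t → toℕ e ℕ.< t
∈-prefix⁻ {t = t} {e} e∈ = ℕₚ.<ᵇ⇒< (toℕ e) t (subst T (sym (∈-tabulate⁻ e∈)) _)

∈-allSubsets : ∀ {n} (S : Subset n) → S ∈ₗ allSubsets n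
∈-allSubsets []      = here refl
∈-allSubsets (b ∷ S) = extend b (∈-allSubsets S)
  where
  extend : ∀ {n} {S : Subset n} {Ss} b → S ∈ₗ Ss →
           (b ∷ S) ∈ₗ foldr (λ s acc → (true ∷ s) ∷ (false ∷ s) ∷ acc) [] Ss
  extend true  (here refl) = here refl
  extend false (here refl) = there (here refl)
  extend b     (there S∈)  = there (there (extend b S∈))

maxℕ-upper : ∀ {A : Set} (f : A → ℕ) {x xs} → x ∈ₗ xs → f x ℕ.≤ maxℕ (map f xs)
maxℕ-upper f {xs = y ∷ ys} (here refl) = ℕₚ.m≤m⊔n _ _
maxℕ-upper f {xs = y ∷ ys} (there x∈)  =
  ℕₚ.≤-trans (maxℕ-upper f x∈) (ℕₚ.m≤n⊔m (f y) _)

maxℕ-least : ∀ {A : Set} (f : A → ℕ) {m} xs → (∀ x → f x ℕ.≤ m) → maxℕ (map f xs) ℕ.≤ m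
maxℕ-least f []       f≤m = z≤n
maxℕ-least f (x ∷ xs) f≤m = ℕₚ.⊔-lub (f≤m x) (maxℕ-least f xs f≤m)

-- Rank as the largest size of an independent subset

module _ {n : ℕ} (M : Matroid n) where
  open Matroid M

  indep⇒∣∣≤rank : ∀ {A S} → A ⊆ S → Indep A → ∣ A ∣ ℕ.≤ rank M S
  indep⇒∣∣≤rank {A} {S} A⊆S indA = subst (ℕ._≤ rank M S) size (maxℕ-upper _ (∈-allSubsets A))
    where
    size : (if does (A ⊆? S) ∧ does (indep? A) then ∣ A ∣ else 0) ≡ ∣ A ∣
    size rewrite dec-true (A ⊆? S) A⊆S | dec-true (indep? A) indA = refl

  rank-least : ∀ {S m} → (∀ {A} → A ⊆ S → Indep A → ∣ A ∣ ℕ.≤ m) → rank M S ℕ.≤ m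
  rank-least {S} {m} bound = maxℕ-least _ (allSubsets n) size
    where
    size : ∀ A → (if does (A ⊆? S) ∧ does (indep? A) then ∣ A ∣ else 0) ℕ.≤ m
    size A with A ⊆? S | indep? A
    ... | yes A⊆S | yes indA = bound A⊆S indA
    ... | yes _   | no _     = z≤n
    ... | no _    | _        = z≤n

  rank-mono : ∀ {S T} → S ⊆ T → rank M S ℕ.≤ rank M T
  rank-mono S⊆T = rank-least λ A⊆S → indep⇒∣∣≤rank (S⊆T ∘ A⊆S)

  rank≤rankM : ∀ {S} → rank M S ℕ.≤ rankM M
  rank≤rankM = rank-mono λ _ → ∈-tabulate⁺ refl

  rankM≤rank-prefix : rankM M ℕ.≤ rank M (prefix n)
  rankM≤rank-prefix = rank-mono λ {x} _ → ∈-prefix⁺ (Finₚ.toℕ<n x)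

  rank-prefix-zero : rank M (prefix 0) ℕ.≤ 0
  rank-prefix-zero = rank-least λ {A} A⊆ _ →
    subst (∣ A ∣ ℕ.≤_) (∣⊥∣≡0 n) (p⊆q⇒∣p∣≤∣q∣ {p = A} {⊥} λ x∈ → contradiction (∈-prefix⁻ {t = 0} (A⊆ x∈)) λ ())

  -- An independent set of the longer prefix loses at most `e` when cut down to the shorter one.
  -- Hence one doubling of `r*` per arrival keeps `r*` above the rank.
  rank-prefix-suc : ∀ e → rank M (prefix (suc (toℕ e))) ℕ.≤ suc (rank M (prefix (toℕ e)))
  rank-prefix-suc e = rank-least bound
    where
    bound : ∀ {A} → A ⊆ prefix (suc (toℕ e)) → Indep A → ∣ A ∣ ℕ.≤ suc (rank M (prefix (toℕ e)))
    bound {A} A⊆ indA = begin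
      ∣ A ∣                                       ≡⟨ ∣p∣≡∣p∩q∣+∣p∩∁q∣ A ⁅ e ⁆ ⟩
      ∣ A ∩ ⁅ e ⁆ ∣ ℕ.+ ∣ A ∩ ∁ ⁅ e ⁆ ∣           ≤⟨ ℕₚ.+-mono-≤ (∣p∩q∣≤∣q∣ A ⁅ e ⁆) (indep⇒∣∣≤rank rest⊆ (indep-⊆ (p∩q⊆p A _) indA)) ⟩
      ∣ ⁅ e ⁆ ∣ ℕ.+ rank M (prefix (toℕ e))       ≡⟨ cong (ℕ._+ rank M (prefix (toℕ e))) (∣⁅x⁆∣≡1 e) ⟩
      suc (rank M (prefix (toℕ e)))               ∎
      where
      open ℕₚ.≤-Reasoning
      rest⊆ : A ∩ ∁ ⁅ e ⁆ ⊆ prefix (toℕ e)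
      rest⊆ {x} x∈ with x∈p∩q⁻ A (∁ ⁅ e ⁆) x∈
      ... | x∈A , x∈∁ = ∈-prefix⁺ (ℕₚ.≤∧≢⇒< (ℕ.s≤s⁻¹ (∈-prefix⁻ (A⊆ x∈A))) x≢e)
        where
        x≢e : toℕ x ≢ toℕ e
        x≢e eq = x∈∁p⇒x∉p x∈∁ (subst (_∈ ⁅ e ⁆) (sym (Finₚ.toℕ-injective eq)) (x∈⁅x⁆ e))

  -- Otherwise no independent set would be larger than {a}.
  another-nonloop : 2 ℕ.≤ rankM M → ∀ a → Indep ⁅ a ⁆ → ∃ λ b → Indep ⁅ b ⁆ × b ≢ a
  another-nonloop 2≤r a inda with Finₚ.any? (λ b → indep? (⁅ b ⁆ ∪ ⁅ a ⁆) ×-dec ¬? (b Finₚ.≟ a))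
  ... | yes (b , ind , b≢a) = b , indep-⊆ (p⊆p∪q ⁅ a ⁆) ind , b≢a
  ... | no none = contradiction (ℕₚ.≤-trans 2≤r (rank-least λ _ → size≤1)) λ { (s≤s ()) }
    where
    size≤1 : ∀ {A} → Indep A → ∣ A ∣ ℕ.≤ 1
    size≤1 {A} indA with ∣ A ∣ ℕₚ.≤? 1
    ... | yes ≤1 = ≤1
    ... | no ≰1 with exchange inda indA (subst (ℕ._< ∣ A ∣) (sym (∣⁅x⁆∣≡1 a)) (ℕₚ.≰⇒> ≰1))
    ...   | x , _ , x∉ , ind = contradiction (x , ind , λ { refl → x∉ (x∈⁅x⁆ a) }) none

-- Arithmetic of naturals and their inverses inside the rationals

ι : ℕ → ℚ
ι m = + m / 1

-- `_/_` divides by a gcd that does not reduce for a variable `m`. In the unnormalised rationals,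
-- equations become integer cross products.
toℚᵘ-ι : ∀ m → toℚᵘ (ι m) ℚᵘ.≃ mkℚᵘ (+ m) 0
toℚᵘ-ι m = toℚᵘ-fromℚᵘ (mkℚᵘ (+ m) 0)

ι-+ : ∀ m n → ι (m ℕ.+ n) ≡ ι m + ι n
ι-+ m n = toℚᵘ-injective (begin
  toℚᵘ (ι (m ℕ.+ n))             ≈⟨ toℚᵘ-ι (m ℕ.+ n) ⟩
  mkℚᵘ (+ (m ℕ.+ n)) 0           ≈⟨ *≡* (cong₂ (λ x y → (x ℤ.+ y) ℤ.* + 1) (sym (ℤₚ.*-identityʳ (+ m))) (sym (ℤₚ.*-identityʳ (+ n)))) ⟩
  mkℚᵘ (+ m) 0 ℚᵘ.+ mkℚᵘ (+ n) 0 ≈⟨ ℚᵘₚ.+-cong (toℚᵘ-ι m) (toℚᵘ-ι n) ⟨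
  toℚᵘ (ι m) ℚᵘ.+ toℚᵘ (ι n)     ≈⟨ toℚᵘ-homo-+ (ι m) (ι n) ⟨
  toℚᵘ (ι m + ι n)               ∎)
  where open ℚᵘₚ.≃-Reasoning

ι-*-inv : ∀ m .{{_ : ℕ.NonZero m}} → ι m * inv m ≡ 1ℚ
ι-*-inv (suc k) = toℚᵘ-injective (begin
  toℚᵘ (ι m * inv m)                ≈⟨ toℚᵘ-homo-* (ι m) (inv m) ⟩
  toℚᵘ (ι m) ℚᵘ.* toℚᵘ (inv m)      ≈⟨ ℚᵘₚ.*-cong (toℚᵘ-ι m) (toℚᵘ-fromℚᵘ (mkℚᵘ (+ 1) k)) ⟩
  mkℚᵘ (+ m) 0 ℚᵘ.* mkℚᵘ (+ 1) k    ≈⟨ *≡* cross ⟩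
  toℚᵘ 1ℚ                           ∎)
  where
  open ℚᵘₚ.≃-Reasoning
  m = suc k
  cross : + m ℤ.* + 1 ℤ.* + 1 ≡ + 1 ℤ.* + (1 ℕ.* m)
  cross = trans (ℤₚ.*-identityʳ _) (trans (ℤₚ.*-comm (+ m) (+ 1))
    (cong (λ x → + 1 ℤ.* + x) (sym (ℕₚ.*-identityˡ m))))

0≤ι : ∀ m → 0ℚ ≤ ι m
0≤ι m = nonNegative⁻¹ (ι m) {{normalize-nonNeg m 1}}

0<inv : ∀ m .{{_ : ℕ.NonZero m}} → 0ℚ < inv m
0<inv (suc k) = positive⁻¹ (inv (suc k)) {{normalize-pos 1 (suc k)}}

*-monoˡ-≤ : ∀ {p q r} → 0ℚ ≤ r → p ≤ q → r * p ≤ r * q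
*-monoˡ-≤ {r = r} 0≤r = *-monoˡ-≤-nonNeg r {{ℚ.nonNegative 0≤r}}

*-monoʳ-≤ : ∀ {p q r} → 0ℚ ≤ r → p ≤ q → p * r ≤ q * r
*-monoʳ-≤ {r = r} 0≤r = *-monoʳ-≤-nonNeg r {{ℚ.nonNegative 0≤r}}

0≤* : ∀ {p q} → 0ℚ ≤ p → 0ℚ ≤ q → 0ℚ ≤ p * q
0≤* {p} {q} 0≤p 0≤q = subst (_≤ p * q) (*-zeroʳ p) (*-monoˡ-≤ 0≤p 0≤q)

p≤p+q : ∀ {p q} → 0ℚ ≤ q → p ≤ p + q
p≤p+q {p} {q} 0≤q = subst (_≤ p + q) (+-identityʳ p) (+-monoʳ-≤ p 0≤q)

ι-mono-≤ : ∀ {m n} → m ℕ.≤ n → ι m ≤ ι n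
ι-mono-≤ {m} {n} m≤n =
  subst (ι m ≤_) (trans (sym (ι-+ m (n ℕ.∸ m))) (cong ι (ℕₚ.m+[n∸m]≡n m≤n))) (p≤p+q (0≤ι (n ℕ.∸ m)))

inv-double : ∀ m .{{_ : ℕ.NonZero m}} → inv m ≡ inv (2 ℕ.* m) + inv (2 ℕ.* m)
inv-double m@(suc _) = begin
  inv m                                         ≡⟨ *-identityʳ (inv m) ⟨
  inv m * 1ℚ                                    ≡⟨ cong (inv m *_) (ι-*-inv (2 ℕ.* m)) ⟨
  inv m * (ι (2 ℕ.* m) * inv (2 ℕ.* m))         ≡⟨ cong (λ x → inv m * (x * inv (2 ℕ.* m))) ι-double ⟩
  inv m * ((ι m + ι m) * inv (2 ℕ.* m))         ≡⟨ regroup (inv m) (ι m) (inv (2 ℕ.* m)) ⟩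
  ι m * inv m * (inv (2 ℕ.* m) + inv (2 ℕ.* m)) ≡⟨ cong (_* (inv (2 ℕ.* m) + inv (2 ℕ.* m))) (ι-*-inv m) ⟩
  1ℚ * (inv (2 ℕ.* m) + inv (2 ℕ.* m))          ≡⟨ *-identityˡ _ ⟩
  inv (2 ℕ.* m) + inv (2 ℕ.* m)                 ∎
  where
  open ≡-Reasoning
  ι-double : ι (2 ℕ.* m) ≡ ι m + ι m
  ι-double = trans (cong (λ x → ι (m ℕ.+ x)) (ℕₚ.+-identityʳ m)) (ι-+ m m)
  regroup : ∀ x y z → x * ((y + y) * z) ≡ y * x * (z + z)
  regroup = solve 3 (λ x y z → x :* ((y :+ y) :* z) := y :* x :* (z :+ z)) refl
    where open +-*-Solver

-- Binary logarithms and the relation `_≤_·log₂_`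

floor-log : ∀ r → 1 ℕ.≤ r → ∃ λ k → 2 ^ k ℕ.≤ r × r ℕ.< 2 ^ suc k
floor-log 1               _ = 0 , s≤s z≤n , s≤s (s≤s z≤n)
floor-log (suc r@(suc _)) _ with floor-log r (s≤s z≤n)
... | k , lo , hi with suc r ℕₚ.<? 2 ^ suc k
...   | yes r+1<  = k , ℕₚ.m≤n⇒m≤1+n lo , r+1<
...   | no  r+1≮ = suc k , ℕₚ.≮⇒≥ r+1≮ , (begin-strict
  suc r                       ≤⟨ hi ⟩
  2 ^ suc k                   <⟨ ℕₚ.^-monoʳ-< 2 (s≤s (s≤s z≤n)) (ℕₚ.n<1+n (suc k)) ⟩
  2 ^ suc (suc k)             ∎)
  where open ℕₚ.≤-Reasoning

cross-multiply : ∀ a c → 0ℚ ≤ a → 0ℚ ≤ c → ∀ k → a ≤ ι k * c →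
                 ℤ.∣ ↥ a ∣ ℕ.* ↧ₙ c ℕ.≤ k ℕ.* (↧ₙ a ℕ.* ℤ.∣ ↥ c ∣)
cross-multiply (mkℚ -[1+ _ ] _ _)   _                   0≤a _   _ _    = contradiction (ℚ.nonNegative 0≤a) λ ()
cross-multiply (mkℚ (+ _) _ _)      (mkℚ -[1+ _ ] _ _)  _   0≤c _ _    = contradiction (ℚ.nonNegative 0≤c) λ ()
cross-multiply a@(mkℚ (+ x) y-1 _)  c@(mkℚ (+ z) w-1 _) _   _   k a≤kc =
  ℤₚ.drop‿+≤+ (subst₂ ℤ._≤_ lhs rhs (ℚᵘₚ.drop-*≤* unnormalised))
  where
  unnormalised : toℚᵘ a ℚᵘ.≤ mkℚᵘ (+ k) 0 ℚᵘ.* toℚᵘ c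
  unnormalised = ℚᵘₚ.≤-respʳ-≃ (ℚᵘₚ.≃-trans (toℚᵘ-homo-* (ι k) c) (ℚᵘₚ.*-congʳ {toℚᵘ c} (toℚᵘ-ι k)))
                               (toℚᵘ-mono-≤ a≤kc)
  lhs : + x ℤ.* + (1 ℕ.* suc w-1) ≡ + (x ℕ.* suc w-1)
  lhs = trans (cong (λ m → + x ℤ.* + m) (ℕₚ.*-identityˡ (suc w-1))) (sym (ℤₚ.pos-* x (suc w-1)))
  rhs : + k ℤ.* + z ℤ.* + suc y-1 ≡ + (k ℕ.* (suc y-1 ℕ.* z))
  rhs = begin
    + k ℤ.* + z ℤ.* + suc y-1   ≡⟨ cong (ℤ._* + suc y-1) (ℤₚ.pos-* k z) ⟨
    + (k ℕ.* z) ℤ.* + suc y-1   ≡⟨ ℤₚ.pos-* (k ℕ.* z) (suc y-1) ⟨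
    + (k ℕ.* z ℕ.* suc y-1)     ≡⟨ cong +_ (ℕₚ.*-assoc k z (suc y-1)) ⟩
    + (k ℕ.* (z ℕ.* suc y-1))   ≡⟨ cong (λ m → + (k ℕ.* m)) (ℕₚ.*-comm z (suc y-1)) ⟩
    + (k ℕ.* (suc y-1 ℕ.* z))   ∎
    where open ≡-Reasoning

-- This is `k ≤ log₂ r` in disguise: clear the denominators of `a ≤ ι k * c`, take both sides as
-- exponents of 2, and replace `2 ^ k` by `r`.
≤ι*⇒≤·log₂ : ∀ {a c} k {r} → a ≤ ι k * c → 2 ^ k ℕ.≤ r → a ≤ c ·log₂ r
≤ι*⇒≤·log₂ {a} {c} k {r} a≤kc 2^k≤r with a ≤? 0ℚ
... | yes a≤0 = inj₁ a≤0
... | no  a≰0 = inj₂ (0<c , (begin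
  2 ^ (num a ℕ.* ↧ₙ c)         ≤⟨ ℕₚ.^-monoʳ-≤ 2 (cross-multiply a c (<⇒≤ (≰⇒> a≰0)) (<⇒≤ 0<c) k a≤kc) ⟩
  2 ^ (k ℕ.* (↧ₙ a ℕ.* num c)) ≡⟨ ℕₚ.^-*-assoc 2 k (↧ₙ a ℕ.* num c) ⟨
  (2 ^ k) ^ (↧ₙ a ℕ.* num c)   ≤⟨ ℕₚ.^-monoˡ-≤ (↧ₙ a ℕ.* num c) 2^k≤r ⟩
  r ^ (↧ₙ a ℕ.* num c)         ∎))
  where
  open ℕₚ.≤-Reasoning

  num : ℚ → ℕ
  num p = ℤ.∣ ↥ p ∣

  0<c : 0ℚ < c
  0<c with 0ℚ <? c
  ... | yes 0<c = 0<c
  ... | no  0≮c = contradiction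
    (≤-trans a≤kc (subst (ι k * c ≤_) (*-zeroʳ (ι k)) (*-monoˡ-≤ (0≤ι k) (≮⇒≥ 0≮c)))) a≰0

-- Weights of sets as sums

weight-∷ : ∀ {n} (ω : Fin (suc n) → ℚ) b S →
           weight ω (b ∷ S) ≡ (if b then ω zero else 0ℚ) + weight (ω ∘ suc) S
weight-∷ {n} ω b S = cong (λ xs → (if b then ω zero else 0ℚ) + foldr _+_ 0ℚ xs)
  -- As tabulations the tail of `allFin (suc n)` and `allFin n` give the same list, which exposes
  -- the recursion along the vector.
  (trans (map-tabulate suc _) (sym (map-tabulate {n = n} id _)))

weight-mono : ∀ {n} {f g : Fin n → ℚ} S → (∀ {e} → e ∈ S → f e ≤ g e) → weight f S ≤ weight g S
weight-mono {f = f} {g} [] f≤g = ≤-refl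
weight-mono {f = f} {g} (b ∷ S) f≤g = subst₂ _≤_ (sym (weight-∷ f b S)) (sym (weight-∷ g b S))
  (+-mono-≤ (head b f≤g) (weight-mono S (f≤g ∘ there)))
  where
  head : ∀ b → (∀ {e} → e ∈ (b ∷ S) → f e ≤ g e) →
         (if b then f zero else 0ℚ) ≤ (if b then g zero else 0ℚ)
  head true  f≤g = f≤g here
  head false f≤g = ≤-refl

weight-+ : ∀ {n} (f g : Fin n → ℚ) S → weight (λ e → f e + g e) S ≡ weight f S + weight g S
weight-+ f g []      = refl
weight-+ f g (b ∷ S) = begin
  weight (λ e → f e + g e) (b ∷ S)     ≡⟨ weight-∷ _ b S ⟩
  (if b then f zero + g zero else 0ℚ) + weight (λ e → f (suc e) + g (suc e)) S
    ≡⟨ cong₂ _+_ (head b) (weight-+ (f ∘ suc) (g ∘ suc) S) ⟩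
  (f₀ + g₀) + (weight (f ∘ suc) S + weight (g ∘ suc) S)
    ≡⟨ solve 4 (λ a b c d → (a :+ b) :+ (c :+ d) := (a :+ c) :+ (b :+ d)) refl f₀ g₀ _ _ ⟩
  (f₀ + weight (f ∘ suc) S) + (g₀ + weight (g ∘ suc) S)
    ≡⟨ cong₂ _+_ (weight-∷ f b S) (weight-∷ g b S) ⟨
  weight f (b ∷ S) + weight g (b ∷ S)  ∎
  where
  open ≡-Reasoning
  open +-*-Solver
  f₀ = if b then f zero else 0ℚ
  g₀ = if b then g zero else 0ℚ
  head : ∀ b → (if b then f zero + g zero else 0ℚ) ≡
               (if b then f zero else 0ℚ) + (if b then g zero else 0ℚ)
  head true  = refl
  head false = refl

ι-suc-* : ∀ m c → ι (suc m) * c ≡ c + ι m * c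
ι-suc-* m c = trans (cong (_* c) (ι-+ 1 m))
  (trans (*-distribʳ-+ c 1ℚ (ι m)) (cong (_+ ι m * c) (*-identityˡ c)))

weight-const : ∀ {n} c (S : Subset n) → weight (λ _ → c) S ≡ ι ∣ S ∣ * c
weight-const c []          = sym (*-zeroˡ c)
weight-const c (true ∷ S)  = trans (weight-∷ (λ _ → c) true S)
  (trans (cong (_+_ c) (weight-const c S)) (sym (ι-suc-* ∣ S ∣ c)))
weight-const c (false ∷ S) = trans (weight-∷ (λ _ → c) false S) (trans (+-identityˡ _) (weight-const c S))

indicator : ∀ {n} → Subset n → ℚ → Fin n → ℚ
indicator T c e = if lookup T e then c else 0ℚ

weight-indicator : ∀ {n} c (S T : Subset n) →
                   weight (indicator T c) S ≡ ι ∣ S ∩ T ∣ * c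
weight-indicator c []          []          = sym (*-zeroˡ c)
weight-indicator c (true ∷ S)  (true ∷ T)  = trans (weight-∷ (indicator (true ∷ T) c) true S)
  (trans (cong (_+_ c) (weight-indicator c S T)) (sym (ι-suc-* ∣ S ∩ T ∣ c)))
weight-indicator c (true ∷ S)  (false ∷ T) =
  trans (weight-∷ (indicator (false ∷ T) c) true S) (trans (+-identityˡ _) (weight-indicator c S T))
weight-indicator c (false ∷ S) (b ∷ T)     =
  trans (weight-∷ (indicator (b ∷ T) c) false S) (trans (+-identityˡ _) (weight-indicator c S T))

-- The last term is split off, so `sum< (suc j) h` unfolds to `sum< j h + h j`, as needed when a
-- doubling brings in one more threshold.
sum< : ℕ → (ℕ → ℚ) → ℚ
sum< zero    f = 0ℚ
sum< (suc k) f = sum< k f + f k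

sum<-mono : ∀ {f g} k → (∀ i → f i ≤ g i) → sum< k f ≤ sum< k g
sum<-mono zero    f≤g = ≤-refl
sum<-mono (suc k) f≤g = +-mono-≤ (sum<-mono k f≤g) (f≤g k)

sum<-nonneg : ∀ {f} k → (∀ i → 0ℚ ≤ f i) → 0ℚ ≤ sum< k f
sum<-nonneg zero    0≤f = ≤-refl
sum<-nonneg (suc k) 0≤f = +-mono-≤ (sum<-nonneg k 0≤f) (0≤f k)

sum<-+-const : ∀ f c k → sum< k (λ i → f i + c) ≡ sum< k f + ι k * c
sum<-+-const f c zero    = sym (trans (+-identityˡ _) (*-zeroˡ c))
sum<-+-const f c (suc k) = trans (cong (_+ (f k + c)) (sum<-+-const f c k))
  (trans (regroup (sum< k f) (ι k * c) (f k) c)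
         (cong (_+_ (sum< k f + f k)) (sym (ι-suc-* k c))))
  where
  open +-*-Solver
  regroup : ∀ s m x c → s + m + (x + c) ≡ s + x + (c + m)
  regroup = solve 4 (λ s m x c → s :+ m :+ (x :+ c) := s :+ x :+ (c :+ m)) refl

weight-sum< : ∀ {n} (f : ℕ → Fin n → ℚ) k S →
              weight (λ e → sum< k (λ i → f i e)) S ≡ sum< k (λ i → weight (f i) S)
weight-sum< f zero    S = trans (weight-const 0ℚ S) (*-zeroʳ (ι ∣ S ∣))
weight-sum< f (suc k) S = trans (weight-+ _ (f k) S) (cong (_+ weight (f k) S) (weight-sum< f k S))

-- The averaging step and the order of arrival

if-elim : ∀ {A : Set} (P : A → Set) b {x y} →
          (b ≡ true → P x) → (b ≡ false → P y) → P (if b then x else y)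
if-elim P true  onTrue onFalse = onTrue refl
if-elim P false onTrue onFalse = onFalse refl

-- Average the two bounds with weights `p = 1/(j+1)` and `1 - p = j/(j+1)`: the left sides
-- contribute `y` and `j x`, and this `y` cancels the one on the right. It is the induction step
-- behind the uniform final threshold, with `x` the value of the old threshold and `y` that of the
-- new one.
mixture-bound : ∀ j {B₁ B₀ x y S s K} →
  ι (suc j) * y + S ≤ K * B₁ + (s + y) →
  ι (suc j) * x + S ≤ K * B₀ + (s + y) →
  ι j * x + S ≤ K * (inv (suc j) * B₁ + (1ℚ - inv (suc j)) * B₀) + s
mixture-bound j {B₁} {B₀} {x} {y} {S} {s} {K} bound₁ bound₀ = begin
  J * x + S
    ≡⟨ solve 4 (λ J x S y → J :* x :+ S := con 1ℚ :* (y :+ J :* x :+ S) :- y) refl J x S y ⟩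
  1ℚ * (y + J * x + S) - y
    -- Inserting `p * (1ℚ + J) = 1ℚ` makes the two weights `p` and `p * J` visible.
    ≡⟨ cong (λ u → u * (y + J * x + S) - y) unit ⟨
  p * (1ℚ + J) * (y + J * x + S) - y
    ≡⟨ solve 5 (λ p J x S y → p :* (con 1ℚ :+ J) :* (y :+ J :* x :+ S) :- y
         := p :* ((con 1ℚ :+ J) :* y :+ S) :+ p :* J :* ((con 1ℚ :+ J) :* x :+ S) :- y) refl p J x S y ⟩
  p * ((1ℚ + J) * y + S) + p * J * ((1ℚ + J) * x + S) - y
    ≤⟨ +-monoˡ-≤ (ℚ.- y) (+-mono-≤ (*-monoˡ-≤ 0≤p (shift y bound₁)) (*-monoˡ-≤ (0≤* 0≤p (0≤ι j)) (shift x bound₀))) ⟩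
  p * (K * B₁ + (s + y)) + p * J * (K * B₀ + (s + y)) - y
    ≡⟨ solve 7 (λ p J K B₁ B₀ s y → p :* (K :* B₁ :+ (s :+ y)) :+ p :* J :* (K :* B₀ :+ (s :+ y)) :- y
         := K :* (p :* B₁ :+ p :* J :* B₀) :+ p :* (con 1ℚ :+ J) :* (s :+ y) :- y) refl p J K B₁ B₀ s y ⟩
  K * (p * B₁ + p * J * B₀) + p * (1ℚ + J) * (s + y) - y
    ≡⟨ cong₂ (λ q u → K * (p * B₁ + q * B₀) + u * (s + y) - y) (sym 1-p) unit ⟩
  K * (p * B₁ + (1ℚ - p) * B₀) + 1ℚ * (s + y) - y
    ≡⟨ solve 3 (λ z s y → z :+ con 1ℚ :* (s :+ y) :- y := z :+ s) refl (K * (p * B₁ + (1ℚ - p) * B₀)) s y ⟩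
  K * (p * B₁ + (1ℚ - p) * B₀) + s ∎
  where
  open ≤-Reasoning
  open +-*-Solver
  p = inv (suc j)
  J = ι j
  0≤p : 0ℚ ≤ p
  0≤p = <⇒≤ (0<inv (suc j))
  unit : p * (1ℚ + J) ≡ 1ℚ
  unit = trans (*-comm p (1ℚ + J)) (trans (cong (_* p) (sym (ι-+ 1 j))) (ι-*-inv (suc j)))
  1-p : 1ℚ - p ≡ p * J
  1-p = trans (cong (_- p) (sym unit))
    (solve 2 (λ p J → p :* (con 1ℚ :+ J) :- p := p :* J) refl p J)
  shift : ∀ z {c} → ι (suc j) * z + S ≤ c → (1ℚ + J) * z + S ≤ c
  shift z {c} = subst (λ u → u * z + S ≤ c) (ι-+ 1 j)

2^-cancel-< : ∀ {i j} → 2 ^ i ℕ.< 2 ^ j → i ℕ.< j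
2^-cancel-< {i} {j} lt = ℕₚ.≰⇒> λ j≤i → ℕₚ.<⇒≱ lt (ℕₚ.^-monoʳ-≤ 2 j≤i)

-- Ties the remaining list to the clock: at time `t` it consists of the positions from `t` on. The
-- prefix ranked by the algorithm is thus the one in the invariant, and the empty list forces
-- `t = n`.
data Arrivals {n : ℕ} : ℕ → List (Fin n) → Set where
  []  : Arrivals n []
  _∷_ : ∀ e {es} → Arrivals (suc (toℕ e)) es → Arrivals (toℕ e) (e ∷ es)

allFin-arrivals : ∀ n → Arrivals 0 (allFin n)
allFin-arrivals n = go id 0 (λ _ → refl) refl
  where
  go : ∀ {m} (f : Fin m → Fin n) t → (∀ i → toℕ (f i) ≡ t ℕ.+ toℕ i) → t ℕ.+ m ≡ n →
       Arrivals t (List.tabulate f)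
  go {zero}  f t f≡ t≡ = subst (λ u → Arrivals u []) (trans (sym t≡) (ℕₚ.+-identityʳ t)) []
  go {suc m} f t f≡ t≡ = subst (λ u → Arrivals u (List.tabulate f)) f0≡t
    (f zero ∷ subst (λ u → Arrivals (suc u) (List.tabulate (f ∘ suc))) (sym f0≡t)
      (go (f ∘ suc) (suc t) (λ i → trans (f≡ (suc i)) (ℕₚ.+-suc t (toℕ i))) (trans (sym (ℕₚ.+-suc t m)) t≡)))
    where
    f0≡t : toℕ (f zero) ≡ t
    f0≡t = trans (f≡ zero) (ℕₚ.+-identityʳ t)

-- Thresholds, heavy elements of `OPT` and the invariant

module Analysis {n : ℕ} (M : Matroid n) (ω : Fin n → ℚ) (L : ℚ) (0<L : 0ℚ < L)
                (OPT : Subset n) (indOPT : Matroid.Indep M OPT) where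
  open Matroid M
  open Algorithm M ω L

  -- `θ 0 = L` serves only as a cap on weights; the thresholds of the algorithm start at `θ 1`,
  -- whence the shift `suc i` below.
  θ : ℕ → ℚ
  θ i = L * inv (2 ^ i)

  0≤θ : ∀ i → 0ℚ ≤ θ i
  0≤θ i = 0≤* (<⇒≤ 0<L) (<⇒≤ (0<inv (2 ^ i) {{ℕₚ.m^n≢0 2 i}}))

  θ-double : ∀ i → θ i ≡ θ (suc i) + θ (suc i)
  θ-double i = trans (cong (L *_) (inv-double (2 ^ i) {{ℕₚ.m^n≢0 2 i}})) (*-distribˡ-+ L _ _)

  ι*θ≡L : ∀ i → ι (2 ^ i) * θ i ≡ L
  ι*θ≡L i = begin
    ι (2 ^ i) * (L * inv (2 ^ i)) ≡⟨ solve 3 (λ x l y → x :* (l :* y) := l :* (x :* y)) refl (ι (2 ^ i)) L (inv (2 ^ i)) ⟩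
    L * (ι (2 ^ i) * inv (2 ^ i)) ≡⟨ cong (L *_) (ι-*-inv (2 ^ i) {{ℕₚ.m^n≢0 2 i}}) ⟩
    L * 1ℚ                        ≡⟨ *-identityʳ L ⟩
    L                             ∎
    where
    open ≡-Reasoning
    open +-*-Solver

  θ-anti : ∀ {i j} → i ℕ.≤ j → θ j ≤ θ i
  θ-anti {i} i≤j = go (ℕₚ.≤⇒≤′ i≤j)
    where
    go : ∀ {j} → i ℕ.≤′ j → θ j ≤ θ i
    go ℕ.≤′-refl           = ≤-refl
    go (ℕ.≤′-step {j} i≤j) = ≤-trans (subst (θ (suc j) ≤_) (sym (θ-double j)) (p≤p+q (0≤θ (suc j)))) (go i≤j)

  heavy : ℕ → Subset n
  heavy i = tabulate (λ e → does (θ (suc i) <? ω e))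

  ∈-heavy⁻ : ∀ {i e} → e ∈ heavy i → θ (suc i) < ω e
  ∈-heavy⁻ {i} {e} e∈ = does⇒ (θ (suc i) <? ω e) (∈-tabulate⁻ e∈)
    where
    does⇒ : ∀ {A : Set} (a? : Dec A) → does a? ≡ true → A
    does⇒ (yes a) _ = a

  C : ℕ → Subset n
  C i = OPT ∩ heavy i

  -- How many elements of `C i` surely arrive after `θ (suc i)` may come into force; truncated to 0
  -- if `C i` has at most `2 ^ i` elements.
  d : ℕ → ℕ
  d i = ∣ C i ∣ ℕ.∸ 2 ^ i

  -- The weight guaranteed when `θ (suc i)` is the final threshold.
  h : ℕ → ℚ
  h i = ι (d i) * θ (suc i)

  -- late collects the elements of C i arriving once θ (suc i) may be in force; spanned says that every one
  -- that has arrived by time t was accepted or is in the span of alg.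
  record Good (i t : ℕ) (alg : Subset n) : Set where
    field
      alg-indep : Indep alg
      alg-heavy : ∀ {e} → e ∈ alg → θ (suc i) < ω e
      late      : Subset n
      late⊆C    : late ⊆ C i
      late-size : d i ℕ.≤ ∣ late ∣
      spanned   : ∀ {e} → e ∈ late → toℕ e ℕ.< t → Indep (⁅ e ⁆ ∪ alg) → e ∈ alg
  open Good

  -- Use and preservation of the invariant

  final-weight : ∀ {i alg} → Good i n alg → h i ≤ weight ω alg
  final-weight {i} {alg} good = begin
    ι (d i) * θ (suc i)          ≤⟨ *-monoʳ-≤ (0≤θ (suc i)) (ι-mono-≤ (ℕₚ.≤-trans (late-size good) late≤alg)) ⟩
    ι ∣ alg ∣ * θ (suc i)        ≡⟨ weight-const (θ (suc i)) alg ⟨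
    weight (λ _ → θ (suc i)) alg ≤⟨ weight-mono alg (λ e∈ → <⇒≤ (alg-heavy good e∈)) ⟩
    weight ω alg                 ∎
    where
    open ≤-Reasoning
    late≤alg : ∣ late good ∣ ℕ.≤ ∣ alg ∣
    late≤alg with ∣ late good ∣ ℕₚ.≤? ∣ alg ∣
    ... | yes ≤alg = ≤alg
    -- Were `late` larger, exchange would extend `alg` by a late element outside it, although every
    -- late element has arrived and is spanned.
    ... | no  ≰alg with exchange (alg-indep good) (indep-⊆ (p∩q⊆p OPT (heavy i) ∘ late⊆C good) indOPT) (ℕₚ.≰⇒> ≰alg)
    ...   | x , x∈late , x∉alg , ind = contradiction (spanned good x∈late (Finₚ.toℕ<n x) ind) x∉alg

  -- Enlarging `alg` only enlarges its span: if `x` can be added to the larger set, it can be added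
  -- to the smaller one.
  grow : ∀ {i t e alg} → θ (suc i) < ω e → Indep (⁅ e ⁆ ∪ alg) → Good i t alg → Good i t (⁅ e ⁆ ∪ alg)
  grow {i} {t} {e} {alg} θ<ω ind good = record
    { alg-indep = ind
    ; alg-heavy = λ x∈ → case x∈p∪q⁻ ⁅ e ⁆ alg x∈ of λ
        { (inj₁ x∈e)   → subst (λ y → θ (suc i) < ω y) (sym (x∈⁅y⁆⇒x≡y e x∈e)) θ<ω
        ; (inj₂ x∈alg) → alg-heavy good x∈alg }
    ; late      = late good
    ; late⊆C    = late⊆C good
    ; late-size = late-size good
    ; spanned   = λ {x} x∈ x<t indx →
        q⊆p∪q ⁅ e ⁆ alg (spanned good x∈ x<t (indep-⊆ (shrink {x}) indx))
    }
    where
    shrink : ∀ {x} → ⁅ x ⁆ ∪ alg ⊆ ⁅ x ⁆ ∪ (⁅ e ⁆ ∪ alg)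
    shrink {x} y∈ with x∈p∪q⁻ ⁅ x ⁆ alg y∈
    ... | inj₁ y∈x   = p⊆p∪q (⁅ e ⁆ ∪ alg) y∈x
    ... | inj₂ y∈alg = q⊆p∪q ⁅ x ⁆ (⁅ e ⁆ ∪ alg) (q⊆p∪q ⁅ e ⁆ alg y∈alg)

  advance : ∀ {i e alg} (good : Good i (toℕ e) alg) →
            (e ∈ late good → Indep (⁅ e ⁆ ∪ alg) → e ∈ alg) → Good i (suc (toℕ e)) alg
  advance {i} {e} {alg} good spans-e = record
    { alg-indep = alg-indep good
    ; alg-heavy = alg-heavy good
    ; late      = late good
    ; late⊆C    = late⊆C good
    ; late-size = late-size good
    ; spanned   = λ x∈ x≤e → spans x∈ (ℕₚ.m≤n⇒m<n∨m≡n (ℕ.s≤s⁻¹ x≤e))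
    }
    where
    spans : ∀ {x} → x ∈ late good → toℕ x ℕ.< toℕ e ⊎ toℕ x ≡ toℕ e → Indep (⁅ x ⁆ ∪ alg) → x ∈ alg
    spans x∈ (inj₁ x<e) = spanned good x∈ x<e
    spans x∈ (inj₂ x≡e) with refl ← Finₚ.toℕ-injective x≡e = spans-e x∈

  -- An accepted `e` lies in the new set, an `e` rejected for dependence is spanned, and a light `e`
  -- is not in `late`.
  accept-good : ∀ {i e alg} (heavy? : Dec (θ (suc i) < ω e)) (ind? : Dec (Indep (⁅ e ⁆ ∪ alg))) →
    Good i (toℕ e) alg →
    Good i (suc (toℕ e)) (if does heavy? ∧ does ind? then ⁅ e ⁆ ∪ alg else alg)
  accept-good {i} {e} {alg} (yes θ<ω) (yes ind) good = advance (grow {i} θ<ω ind good) λ _ _ → p⊆p∪q alg (x∈⁅x⁆ e)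
  accept-good (yes _) (no ¬ind) good = advance good λ _ ind → contradiction ind ¬ind
  accept-good {i} (no θ≮ω) _ good = advance good λ e∈ _ →
    contradiction (∈-heavy⁻ {i} (p∩q⊆q OPT (heavy i) (late⊆C good e∈))) θ≮ω

  -- `late` is chosen afresh among elements yet to arrive, so `spanned` holds vacuously. The part of
  -- `C j` already seen is independent inside the prefix, hence bounded by its rank.
  lower-threshold : ∀ {i j t alg} → i ℕ.≤ j → rank M (prefix t) ℕ.≤ 2 ^ j → Good i t alg → Good j t alg
  lower-threshold {i} {j} {t} {alg} i≤j rank≤ good = record
    { alg-indep = alg-indep good
    ; alg-heavy = λ e∈ → ≤-<-trans (θ-anti (s≤s i≤j)) (alg-heavy good e∈)
    ; late      = C j ∩ ∁ (prefix t)
    ; late⊆C    = p∩q⊆p (C j) (∁ (prefix t))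
    ; late-size = ℕₚ.m≤n+o⇒m∸n≤o ∣ C j ∣ (2 ^ j) (begin
        ∣ C j ∣                                                ≡⟨ ∣p∣≡∣p∩q∣+∣p∩∁q∣ (C j) (prefix t) ⟩
        ∣ C j ∩ prefix t ∣ ℕ.+ ∣ C j ∩ ∁ (prefix t) ∣          ≤⟨ ℕₚ.+-monoˡ-≤ _ (ℕₚ.≤-trans early≤ rank≤) ⟩
        2 ^ j ℕ.+ ∣ C j ∩ ∁ (prefix t) ∣                       ∎)
    ; spanned   = λ {e} e∈ e<t _ → contradiction (∈-prefix⁺ e<t) (x∈∁p⇒x∉p (p∩q⊆q (C j) (∁ (prefix t)) e∈))
    }
    where
    open ℕₚ.≤-Reasoning
    early≤ : ∣ C j ∩ prefix t ∣ ℕ.≤ rank M (prefix t)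
    early≤ = indep⇒∣∣≤rank M (p∩q⊆q (C j) (prefix t))
      (indep-⊆ (p∩q⊆p OPT (heavy j) ∘ p∩q⊆p (C j) (prefix t)) indOPT)

  initial-good : Good 0 0 ⊥
  initial-good = record
    { alg-indep = indep-∅
    ; alg-heavy = λ e∈ → contradiction e∈ ∉⊥
    ; late      = C 0
    ; late⊆C    = id
    ; late-size = ℕₚ.m∸n≤m ∣ C 0 ∣ 1
    ; spanned   = λ _ ()
    }

  -- Slicing a weight along the thresholds

  layers : ℕ → Fin n → ℚ
  layers k e = sum< k (λ i → indicator (heavy i) (θ (suc i)) e)

  0≤layers : ∀ k e → 0ℚ ≤ layers k e
  0≤layers k e = sum<-nonneg k λ i → if-elim (0ℚ ≤_) (lookup (heavy i) e) (λ _ → 0≤θ (suc i)) (λ _ → ≤-refl)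

  -- Halving: if `ω e` exceeds `θ (suc k)`, one half of `θ k` becomes the new layer and the other
  -- the new remainder; otherwise the remainder alone suffices.
  layers-bound : ∀ {e} → ω e ≤ L → ∀ k → ω e ≤ θ k + layers k e
  layers-bound {e} ω≤L zero = subst (ω e ≤_) (sym (trans (+-identityʳ _) (*-identityʳ L))) ω≤L
  layers-bound {e} ω≤L (suc k) rewrite lookup∘tabulate (λ e → does (θ (suc k) <? ω e)) e =
    cases (θ (suc k) <? ω e)
    where
    S = layers k e
    cases : (heavy? : Dec (θ (suc k) < ω e)) → ω e ≤ θ (suc k) + (S + (if does heavy? then θ (suc k) else 0ℚ))
    cases (no θ≮ω) = ≤-trans (≮⇒≥ θ≮ω) (p≤p+q (+-mono-≤ (0≤layers k e) (≤-refl {0ℚ})))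
    cases (yes _)  = ≤-trans (layers-bound ω≤L k) (≤-reflexive
      (trans (cong (_+ S) (θ-double k)) (solve 2 (λ t S → t :+ t :+ S := t :+ (S :+ t)) refl (θ (suc k)) S)))
      where open +-*-Solver

  -- Lower bound for branch (2), upper bound for `OPT`

  module _ (k : ℕ) (2^k≤r : 2 ^ k ℕ.≤ rankM M) (r<2^[1+k] : rankM M ℕ.< 2 ^ suc k) where

    K : ℕ
    K = suc k

    -- In this state w* = L/2^(1+i) is one of the j thresholds used so far; it stays final with probability j/K,
    -- and each later threshold becomes final with probability 1/K.
    branch2-bound : ∀ {t es} → Arrivals t es → ∀ {i j alg} → i ℕ.< j → j ℕ.≤ K →
      rank M (prefix t) ℕ.< 2 ^ j → Good i t alg →
      ι j * h i + sum< K h ≤ ι K * branch2 es alg (2 ^ j) (θ (suc i)) + sum< j h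
    branch2-bound [] {i} {j} {alg} i<j j≤K rank<2^j good
      -- Now the full rank, at least `2 ^ k`, has been reached, so `j = K`: all thresholds have had
      -- their turn and the two sums cancel.
      with refl ← ℕₚ.≤-antisym j≤K (2^-cancel-< (ℕₚ.≤-<-trans 2^k≤r (ℕₚ.≤-<-trans (rankM≤rank-prefix M) rank<2^j)))
      = +-monoˡ-≤ (sum< K h) (*-monoˡ-≤ (0≤ι K) (final-weight good))
    branch2-bound (_∷_ e {es} later) {i} {j} {alg} i<j j≤K rank<2^j good =
      if-elim (λ B → ι j * h i + sum< K h ≤ ι K * B + sum< j h) (2 ^ j ℕ.≤ᵇ rank M (prefix (suc (toℕ e))))
        (λ reached → doubling (ℕₚ.≤ᵇ⇒≤ (2 ^ j) _ (subst T (sym reached) _)))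
        (λ notReached → branch2-bound later i<j j≤K
          (ℕₚ.≰⇒> λ reached → subst T notReached (ℕₚ.≤⇒≤ᵇ reached)) good′)
      where
      alg′ : Subset n
      alg′ = if does (θ (suc i) <? ω e) ∧ does (indep? (⁅ e ⁆ ∪ alg)) then ⁅ e ⁆ ∪ alg else alg
      good′ : Good i (suc (toℕ e)) alg′
      good′ = accept-good {i} (θ (suc i) <? ω e) (indep? (⁅ e ⁆ ∪ alg)) good
      -- The rank passes from below `2 ^ j` to at most `2 ^ j`, so it is exactly `2 ^ j` when the
      -- doubling test succeeds.
      rank≤2^j : rank M (prefix (suc (toℕ e))) ℕ.≤ 2 ^ j
      rank≤2^j = ℕₚ.≤-trans (rank-prefix-suc M e) rank<2^j
      p : ℚ
      p = inv ⌊log₂ 2 ^ suc j ⌋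
      doubling : 2 ^ j ℕ.≤ rank M (prefix (suc (toℕ e))) →
        ι j * h i + sum< K h ≤
        ι K * (p * branch2 es alg′ (2 ^ suc j) (θ (suc j)) + (1ℚ - p) * branch2 es alg′ (2 ^ suc j) (θ (suc i)))
          + sum< j h
      -- With `r* = 2 ^ j` the probability `1/log₂(2r*)` is `1/(j+1)`; the new `r*` and `w*` already
      -- have the required form by computation.
      doubling reached = subst
        (λ m → ι j * h i + sum< K h ≤ ι K * (inv m * B₁ + (1ℚ - inv m) * B₀) + sum< j h)
        (sym (⌊log₂[2^n]⌋≡n (suc j)))
        (mixture-bound j {B₁} {B₀} {h i} {h j} {sum< K h} {sum< j h} {ι K}
          (branch2-bound later ℕₚ.≤-refl j<K rank<2^[1+j] (lower-threshold (ℕₚ.<⇒≤ i<j) rank≤2^j good′))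
          (branch2-bound later (ℕₚ.m<n⇒m<1+n i<j) j<K rank<2^[1+j] good′))
        where
        B₁ = branch2 es alg′ (2 ^ suc j) (θ (suc j))
        B₀ = branch2 es alg′ (2 ^ suc j) (θ (suc i))
        j<K : j ℕ.< K
        j<K = 2^-cancel-< (ℕₚ.≤-<-trans reached (ℕₚ.≤-<-trans (rank≤rankM M) r<2^[1+k]))
        rank<2^[1+j] : rank M (prefix (suc (toℕ e))) ℕ.< 2 ^ suc j
        rank<2^[1+j] = ℕₚ.≤-<-trans rank≤2^j (ℕₚ.^-monoʳ-< 2 (s≤s (s≤s z≤n)) (ℕₚ.n<1+n j))

    -- The algorithm starts with `j = 1` and `i = 0`, where `h 0` occurs on both sides of the bound
    -- and cancels.
    branch2-total : sum< K h ≤ ι K * branch2 (allFin n) ⊥ 2 (L * ½)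
    branch2-total = subst₂ _≤_
      (solve 2 (λ x S → con 1ℚ :* x :+ S :- x := S) refl (h 0) (sum< K h))
      (solve 2 (λ x B → B :+ (con 0ℚ :+ x) :- x := B) refl (h 0) (ι K * B))
      (+-monoˡ-≤ (ℚ.- h 0) (branch2-bound (allFin-arrivals n) (s≤s z≤n) (s≤s z≤n)
        (s≤s (ℕₚ.≤-trans (rank-prefix-zero M) z≤n)) initial-good))
      where
      open +-*-Solver
      B = branch2 (allFin n) ⊥ 2 (L * ½)

    -- The summands pay in turn for `a`, for the remainders `θ K`, for the elements of each slice
    -- beyond `2 ^ i` of them, and for those `2 ^ i`.
    opt-bound : ∀ {a} → L < ω a → (∀ b → Indep ⁅ b ⁆ → b ≢ a → ω b < L) →
                weight ω OPT ≤ ω a + (L + (sum< K h + ι K * L))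
    opt-bound {a} L<ωa small = begin
      weight ω OPT
        ≤⟨ weight-mono OPT pointwise ⟩
      weight (λ e → indicator ⁅ a ⁆ (ω a) e + (θ K + layers K e)) OPT
        ≡⟨ trans (weight-+ (indicator ⁅ a ⁆ (ω a)) (λ e → θ K + layers K e) OPT)
                 (cong (_+_ (weight (indicator ⁅ a ⁆ (ω a)) OPT)) (weight-+ (λ _ → θ K) (layers K) OPT)) ⟩
      weight (indicator ⁅ a ⁆ (ω a)) OPT + (weight (λ _ → θ K) OPT + weight (layers K) OPT)
        ≤⟨ +-mono-≤ top (+-mono-≤ bottom middle) ⟩
      ω a + (L + (sum< K h + ι K * L)) ∎
      where
      open ≤-Reasoning
      0≤ωa : 0ℚ ≤ ω a
      0≤ωa = <⇒≤ (<-trans 0<L L<ωa)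
      pointwise : ∀ {e} → e ∈ OPT → ω e ≤ indicator ⁅ a ⁆ (ω a) e + (θ K + layers K e)
      pointwise {e} e∈ with e Finₚ.≟ a
      ... | yes refl rewrite []=⇒lookup (x∈⁅x⁆ e) = p≤p+q (+-mono-≤ (0≤θ K) (0≤layers K e))
      ... | no e≢a = ≤-trans (layers-bound (<⇒≤ (small e nonloop e≢a)) K)
        (subst (_≤ indicator ⁅ a ⁆ (ω a) e + (θ K + layers K e)) (+-identityˡ _)
          (+-monoˡ-≤ (θ K + layers K e) (if-elim (0ℚ ≤_) (lookup ⁅ a ⁆ e) (λ _ → 0≤ωa) (λ _ → ≤-refl))))
        where
        nonloop : Indep ⁅ e ⁆
        nonloop = indep-⊆ (λ x∈ → subst (_∈ OPT) (sym (x∈⁅y⁆⇒x≡y e x∈)) e∈) indOPT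
      top : weight (indicator ⁅ a ⁆ (ω a)) OPT ≤ ω a
      top = begin
        weight (indicator ⁅ a ⁆ (ω a)) OPT ≡⟨ weight-indicator (ω a) OPT ⁅ a ⁆ ⟩
        ι ∣ OPT ∩ ⁅ a ⁆ ∣ * ω a            ≤⟨ *-monoʳ-≤ 0≤ωa (ι-mono-≤ (∣p∩q∣≤∣q∣ OPT ⁅ a ⁆)) ⟩
        ι ∣ ⁅ a ⁆ ∣ * ω a                  ≡⟨ cong (λ m → ι m * ω a) (∣⁅x⁆∣≡1 a) ⟩
        1ℚ * ω a                           ≡⟨ *-identityˡ (ω a) ⟩
        ω a                                ∎
      bottom : weight (λ _ → θ K) OPT ≤ L
      bottom = begin
        weight (λ _ → θ K) OPT ≡⟨ weight-const (θ K) OPT ⟩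
        ι ∣ OPT ∣ * θ K        ≤⟨ *-monoʳ-≤ (0≤θ K) (ι-mono-≤ (ℕₚ.≤-trans (indep⇒∣∣≤rank M (λ _ → ∈-tabulate⁺ refl) indOPT) (ℕₚ.<⇒≤ r<2^[1+k]))) ⟩
        ι (2 ^ K) * θ K        ≡⟨ ι*θ≡L K ⟩
        L                      ∎
      layer : ∀ i → weight (indicator (heavy i) (θ (suc i))) OPT ≤ h i + L
      layer i = begin
        weight (indicator (heavy i) (θ (suc i))) OPT    ≡⟨ weight-indicator (θ (suc i)) OPT (heavy i) ⟩
        ι ∣ C i ∣ * θ (suc i)                           ≤⟨ *-monoʳ-≤ (0≤θ (suc i)) (ι-mono-≤ split) ⟩
        ι (d i ℕ.+ 2 ^ suc i) * θ (suc i)               ≡⟨ cong (_* θ (suc i)) (ι-+ (d i) (2 ^ suc i)) ⟩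
        (ι (d i) + ι (2 ^ suc i)) * θ (suc i)           ≡⟨ *-distribʳ-+ (θ (suc i)) (ι (d i)) (ι (2 ^ suc i)) ⟩
        h i + ι (2 ^ suc i) * θ (suc i)                 ≡⟨ cong (_+_ (h i)) (ι*θ≡L (suc i)) ⟩
        h i + L                                         ∎
        where
        -- `2 ^ i` is relaxed to `2 ^ suc i` because the latter times `θ (suc i)` is exactly `L`.
        split : ∣ C i ∣ ℕ.≤ d i ℕ.+ 2 ^ suc i
        split = ℕₚ.≤-trans (ℕₚ.m≤n+m∸n ∣ C i ∣ (2 ^ i))
          (ℕₚ.≤-trans (ℕₚ.≤-reflexive (ℕₚ.+-comm (2 ^ i) (d i)))
                      (ℕₚ.+-monoʳ-≤ (d i) (ℕₚ.^-monoʳ-≤ 2 (ℕₚ.n≤1+n i))))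
      middle : weight (layers K) OPT ≤ sum< K h + ι K * L
      middle = begin
        weight (layers K) OPT                                          ≡⟨ weight-sum< (λ i → indicator (heavy i) (θ (suc i))) K OPT ⟩
        sum< K (λ i → weight (indicator (heavy i) (θ (suc i))) OPT) ≤⟨ sum<-mono K layer ⟩
        sum< K (λ i → h i + L)                                     ≡⟨ sum<-+-const h L K ⟩
        sum< K h + ι K * L                                         ∎

-- Branch (1) and the final estimate

module _ {n : ℕ} (M : Matroid n) (ω : Fin n → ℚ) (L : ℚ) where
  open Matroid M
  open Algorithm M ω L

  -- Loops are skipped and every non-loop other than `a` is below `L`, so the scan stops only at
  -- `a`.
  branch1-best : ∀ {a} → Indep ⁅ a ⁆ → L < ω a → (∀ b → Indep ⁅ b ⁆ → b ≢ a → ω b < L) →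
                 ∀ {es} → a ∈ₗ es → branch1 es ≡ ω a
  branch1-best inda L<ωa small {a ∷ _} (here refl)
    rewrite dec-true (indep? ⁅ a ⁆) inda | dec-true (L <? ω a) L<ωa = refl
  branch1-best {a} inda L<ωa small {e ∷ es} (there a∈) with e Finₚ.≟ a
  ... | yes refl = branch1-best inda L<ωa small {e ∷ es} (here refl)
  ... | no e≢a with indep? ⁅ e ⁆
  ...   | no _ = branch1-best inda L<ωa small a∈
  ...   | yes inde rewrite dec-false (L <? ω e) (<-asym (small e inde e≢a)) = branch1-best inda L<ωa small a∈

-- `A` and `B` are the values of the two branches. The hypotheses give `W ≤ (4 + k) A + (2 + k) B`,
-- while the right side is `8 (1 + k) (A + B)`.
combine-bounds : ∀ k {W A B L S} → 0ℚ ≤ L → L ≤ A → 0ℚ ≤ S →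
  W ≤ A + (L + (S + ι (2 ℕ.+ k) * L)) → S ≤ ι (2 ℕ.+ k) * B →
  W ≤ ι (suc k) * (ι 16 * (½ * A + ½ * B))
combine-bounds k {W} {A} {B} {L} {S} 0≤L L≤A 0≤S W≤ S≤ = begin
  W                                               ≤⟨ W≤ ⟩
  A + (L + (S + ι K * L))                         ≤⟨ +-monoʳ-≤ A (+-mono-≤ L≤A (+-mono-≤ S≤ (*-monoˡ-≤ (0≤ι K) L≤A))) ⟩
  A + (A + (ι K * B + ι K * A))                   ≡⟨ cong (λ u → A + (A + (u * B + u * A))) (ι-+ 2 k) ⟩
  -- The coefficients `4 + 7k` and `6 + 7k` are the exact differences to `8 + 8k`.
  A + (A + ((ι 2 + c) * B + (ι 2 + c) * A))       ≤⟨ p≤p+q (+-mono-≤ (0≤* (coeff 4) 0≤A) (0≤* (coeff 6) 0≤B)) ⟩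
  A + (A + ((ι 2 + c) * B + (ι 2 + c) * A)) + ((ι 4 + ι 7 * c) * A + (ι 6 + ι 7 * c) * B)
    ≡⟨ solve 3 (λ c A B → A :+ (A :+ ((con (ι 2) :+ c) :* B :+ (con (ι 2) :+ c) :* A))
                            :+ ((con (ι 4) :+ con (ι 7) :* c) :* A :+ (con (ι 6) :+ con (ι 7) :* c) :* B)
         := (con 1ℚ :+ c) :* (con (ι 16) :* (con ½ :* A :+ con ½ :* B))) refl c A B ⟩
  (1ℚ + c) * (ι 16 * (½ * A + ½ * B))             ≡⟨ cong (_* (ι 16 * (½ * A + ½ * B))) (ι-+ 1 k) ⟨
  ι (suc k) * (ι 16 * (½ * A + ½ * B))            ∎
  where
  open ≤-Reasoning
  open +-*-Solver
  K = 2 ℕ.+ k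
  c = ι k
  coeff : ∀ m → 0ℚ ≤ ι m + ι 7 * c
  coeff m = +-mono-≤ (0≤ι m) (0≤* (0≤ι 7) (0≤ι k))
  0≤A : 0ℚ ≤ A
  0≤A = ≤-trans 0≤L L≤A
  0≤B : 0ℚ ≤ B
  -- The sign of `B` follows from `0 ≤ S ≤ K B` with `K` positive.
  0≤B = *-cancelˡ-≤-pos (ι K) {{normalize-pos K 1}}
    (subst (_≤ ι K * B) (sym (*-zeroʳ (ι K))) (≤-trans 0≤S S≤))

theorem2 : ∀ (n : ℕ) (M : Matroid n) (ω : Fin n → ℚ) (L : ℚ) →
    (∀ e → 0ℚ ≤ ω e) →
    2 ℕ.≤ rankM M →
    Σ (Fin n) (λ a → ¬ Matroid.Loop M a × L < ω a ×
    (∀ b → ¬ Matroid.Loop M b → b ≢ a → ω b < L)) →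
    ∀ (OPT : Subset n) → IsMaxWeightIndep M ω OPT →
    weight ω OPT ≤ ((+ 16 / 1) * Algorithm.expectedALG M ω L) ·log₂ rankM M
theorem2 n M ω L 0≤ω 2≤r (a , nonloop-a , L<ωa , small) OPT (indOPT , _)
  with floor-log (rankM M) (ℕₚ.<⇒≤ 2≤r)
-- Rank at least 2 makes the exponent positive. Written as `suc k`, it is a lower bound for
-- `log₂ r`, and the number of thresholds is `2 + k`.
... | zero  , _   , r<2 = contradiction 2≤r (ℕₚ.<⇒≱ r<2)
... | suc k , 2^≤r , r<2^ = ≤ι*⇒≤·log₂ (suc k) bound 2^≤r
  where
  open Matroid M
  open Algorithm M ω L

  inda : Indep ⁅ a ⁆
  inda = decidable-stable (indep? ⁅ a ⁆) nonloop-a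

  small′ : ∀ b → Indep ⁅ b ⁆ → b ≢ a → ω b < L
  small′ b indb = small b (λ loop → loop indb)

  0<L : 0ℚ < L
  0<L with another-nonloop M 2≤r a inda
  -- The second non-loop `b` gives `0 ≤ ω b < L`.
  ... | b , indb , b≢a = ≤-<-trans (0≤ω b) (small′ b indb b≢a)

  open Analysis M ω L 0<L OPT indOPT

  bound : weight ω OPT ≤ ι (suc k) * (ι 16 * expectedALG)
  bound rewrite branch1-best M ω L inda L<ωa small′ (∈-allFin a) =
    combine-bounds k (<⇒≤ 0<L) (<⇒≤ L<ωa)
      (sum<-nonneg (2 ℕ.+ k) λ i → 0≤* (0≤ι (d i)) (0≤θ (suc i)))
      (opt-bound (suc k) 2^≤r r<2^ L<ωa small′)
      (branch2-total (suc k) 2^≤r r<2^)
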